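{- For each of the following sets $P$ of four generalized patterns there is an integer $k$ such that $|S_n(P)|=0$ for every $n\ge k$: (1) $P=\{1\text{ - }23,2\text{ - }13,3\text{ - }21,r\}$ with $r\in\{12\text{ - }3,1\text{ - }32,13\text{ - }2,3\text{ - }12,31\text{ - }2,21\text{ - }3,2\text{ - }31,23\text{ - }1,32\text{ - }1\}$; (2) $P=\{1\text{ - }23,23\text{ - }1,32\text{ - }1,r\}$ with $r\in\{12\text{ - }3,1\text{ - }32,13\text{ - }2,3\text{ - }12,31\text{ - }2,2\text{ - }13,21\text{ - }3,2\text{ - }31,3\text{ - }21\}$; (3) $P=\{1\text{ - }23,2\text{ - }13,32\text{ - }1,r\}$ with $r\in\{12\text{ - }3,13\text{ - }2,3\text{ - }12,31\text{ - }2,21\text{ - }3,2\text{ - }31\}$; (4) $P=\{1\text{ - }23,12\text{ - }3,3\text{ - }21,r\}$ with $r\in\{31\text{ - }2,1\text{ - }32,23\text{ - }1,32\text{ - }1\}$; (5) $P=\{1\text{ - }23,21\text{ - }3,3\text{ - }21,r\}$ with $r\in\{1\text{ - }32,13\text{ - }2,3\text{ - }12,31\text{ - }2,23\text{ - }1\}$; (6) $P=\{1\text{ - }23,21\text{ - }3,32\text{ - }1,r\}$ with $r\in\{13\text{ - }2,3\text{ - }12,2\text{ - }31\}$; (7) $P=\{1\text{ - }23,2\text{ - }31,32\text{ - }1,13\text{ - }2\}$.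
   Context: $S_n$ is the set of permutations $\pi=\pi_1\pi_2\cdots\pi_n$ of $\{1,\dots,n\}$. For $abc$ a permutation of $123$, the generalized pattern $a\text{ - }bc$ is contained in $\pi$ if there are indices $i<j$ with $j+1\le n$ such that $\pi_i\pi_j\pi_{j+1}$ is order-isomorphic to $abc$; the generalized pattern $ab\text{ - }c$ is contained in $\pi$ if there are indices $i,k$ with $i+1<k\le n$ such that $\pi_i\pi_{i+1}\pi_k$ is order-isomorphic to $abc$. (Letters not separated by a dash must occur in adjacent positions; letters separated by a dash need not be adjacent.) $\pi$ avoids a pattern if it does not contain it. For a set $P$ of generalized patterns, $S_n(P)$ is the set of $\pi\in S_n$ avoiding every pattern in $P$. -}

module Defs where

open import Data.Fin using (Fin; toℕ; _<_)
open import Data.Fin.Permutation using (Permutation′; _⟨$⟩ʳ_)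
open import Data.List using (List)
open import Data.List.Relation.Unary.All using (All)
open import Data.Nat as ℕ using (ℕ; suc)
open import Data.Product using (Σ-syntax; ∃-syntax; _×_; proj₁)
open import Data.Vec using (Vec; []; _∷_; lookup)
open import Function.Bundles using (Inverse; _⇔_)
open import Level using (0ℓ)
open import Relation.Binary.Bundles using (Setoid)
import Relation.Binary.Construct.On as On
open import Relation.Binary.PropositionalEquality as ≡ using (_≡_; _→-setoid_)
open import Relation.Nullary using (¬_)

OrderIsomorphic : ∀ {m} → Vec ℕ m → Vec ℕ m → Set
OrderIsomorphic u v = ∀ x y → lookup u x ℕ.< lookup u y ⇔ lookup v x ℕ.< lookup v y

-- a-bc x y z is the pattern x-yz and ab-c x y z is the pattern xy-z.
-- The letters x, y, z are meant to be 1, 2, 3 in some order.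
data Pattern : Set where
  a-bc : (a b c : ℕ) → Pattern
  ab-c : (a b c : ℕ) → Pattern

1-23 1-32 2-13 2-31 3-12 3-21 : Pattern
1-23 = a-bc 1 2 3
1-32 = a-bc 1 3 2
2-13 = a-bc 2 1 3
2-31 = a-bc 2 3 1
3-12 = a-bc 3 1 2
3-21 = a-bc 3 2 1

12-3 13-2 21-3 23-1 31-2 32-1 : Pattern
12-3 = ab-c 1 2 3
13-2 = ab-c 1 3 2
21-3 = ab-c 2 1 3
23-1 = ab-c 2 3 1
31-2 = ab-c 3 1 2
32-1 = ab-c 3 2 1

-- Positions and letters of π are both numbered from 0 rather than from 1.
letters : ∀ {n} → Permutation′ n → (i j k : Fin n) → Vec ℕ 3
letters π i j k = toℕ (π ⟨$⟩ʳ i) ∷ toℕ (π ⟨$⟩ʳ j) ∷ toℕ (π ⟨$⟩ʳ k) ∷ []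

Contains : ∀ {n} → Permutation′ n → Pattern → Set
Contains π (a-bc a b c) = ∃[ i ] ∃[ j ] ∃[ k ]
  i < j × toℕ k ≡ suc (toℕ j) × OrderIsomorphic (letters π i j k) (a ∷ b ∷ c ∷ [])
Contains π (ab-c a b c) = ∃[ i ] ∃[ j ] ∃[ k ]
  toℕ j ≡ suc (toℕ i) × j < k × OrderIsomorphic (letters π i j k) (a ∷ b ∷ c ∷ [])

Avoids : ∀ {n} → Permutation′ n → Pattern → Set
Avoids π p = ¬ Contains π p

-- Permutations are compared as words: Permutation′ n also carries proofs,
-- which propositional equality would distinguish.
S : ℕ → List Pattern → Setoid 0ℓ 0ℓ
S n P = On.setoid {B = Σ[ π ∈ Permutation′ n ] All (Avoids π) P}
  (Fin n →-setoid Fin n) (λ s → proj₁ s ⟨$⟩ʳ_)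

infix 4 ∣_∣≡_

∣_∣≡_ : Setoid 0ℓ 0ℓ → ℕ → Set
∣ A ∣≡ m = Inverse A (≡.setoid (Fin m))

EventuallyZero : List Pattern → Set
EventuallyZero P = ∃[ k ] ∀ n → n ℕ.≥ k → ∣ S n P ∣≡ 0

{-# OPTIONS --safe #-}

-- A factor of a word avoiding the patterns avoids them too, so it suffices that
-- no permutation of length 6 avoids P. This is decided by a search over
-- standardised words that grow by one letter on the left, abandoning a word as
-- soon as it contains a pattern of P.

module Submission where

open import Defs
open import Data.Empty using (⊥-elim)
open import Data.Fin using (Fin; zero; suc; toℕ; punchIn; _<?_)
open import Data.Fin.Properties
  using (0≢1+n; all?; any?; punchIn-cancel-≤; punchIn-mono-≤; punchInᵢ≢i; suc-injective; toℕ-injective)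
open import Data.Fin.Permutation using (Permutation′; _⟨$⟩ʳ_)
open import Data.List using (List; []; _∷_)
open import Data.List.Membership.Propositional using (_∈_)
import Data.List.Relation.Unary.All as All
import Data.List.Relation.Unary.All.Properties as All
open import Data.List.Relation.Unary.Any as Any using (Any)
open import Data.Nat as ℕ using (ℕ; zero; suc; pred; _∸_; _≤_; _<_; _≥_; z≤n; s≤s; s<s; s<s⁻¹; z<s)
open import Data.Nat.Properties as ℕ
  using (≤-refl; ≤-trans; ≤-<-trans; <-irrefl; <-asym; ≤∧≢⇒<; <⇒≱; ≮⇒≥; ≰⇒>; m≤n⇒m∸n≡0; pred[m∸n]≡m∸[1+n])
open import Data.Product using (∃-syntax; _×_; _,_)
open import Data.Sum using (_⊎_; inj₁; inj₂)
open import Data.Vec using (Vec; []; _∷_; lookup; map)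
open import Data.Vec.Properties using (lookup-map)
open import Function using (_∘_; Injective; _⇔_; mk⇔; Equivalence)
open import Function.Bundles using (Injection)
open import Function.Properties.Equivalence using () renaming (trans to ⇔-trans; sym to ⇔-sym)
open import Function.Properties.Inverse using (↔⇒↣)
open import Level using (0ℓ)
open import Relation.Binary.PropositionalEquality using (_≡_; _≢_; refl; sym; cong; subst; subst₂)
open import Relation.Nullary using (Dec; yes; no; contradiction)
open import Relation.Nullary.Decidable using (True; map′; toWitness; _×-dec_; _⊎-dec_; _→-dec_)
open import Relation.Unary using (Pred; Decidable)

private variable
  m n : ℕ
  P : List Pattern

_⇔-dec_ : ∀ {A B : Set} → Dec A → Dec B → Dec (A ⇔ B)
a? ⇔-dec b? = map′ (λ (f , g) → mk⇔ f g) (λ e → Equivalence.to e , Equivalence.from e)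
  ((a? →-dec b?) ×-dec (b? →-dec a?))

-- `Contains` for arbitrary words: the induction passes to suffixes of a permutation, which are no
-- longer permutations.
Occurs : (Fin n → ℕ) → Pattern → Set
Occurs f (a-bc a b c) = ∃[ i ] ∃[ j ] ∃[ k ]
  toℕ i < toℕ j × toℕ k ≡ suc (toℕ j) × OrderIsomorphic (f i ∷ f j ∷ f k ∷ []) (a ∷ b ∷ c ∷ [])
Occurs f (ab-c a b c) = ∃[ i ] ∃[ j ] ∃[ k ]
  toℕ j ≡ suc (toℕ i) × toℕ j < toℕ k × OrderIsomorphic (f i ∷ f j ∷ f k ∷ []) (a ∷ b ∷ c ∷ [])

orderIsomorphic? : (u v : Vec ℕ m) → Dec (OrderIsomorphic u v)
orderIsomorphic? u v = all? λ x → all? λ y →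
  (lookup u x ℕ.<? lookup u y) ⇔-dec (lookup v x ℕ.<? lookup v y)

occurs? : (f : Fin n → ℕ) → Decidable (Occurs f)
occurs? f (a-bc a b c) = any? λ i → any? λ j → any? λ k →
  (i <? j) ×-dec (toℕ k ℕ.≟ suc (toℕ j)) ×-dec
  orderIsomorphic? (f i ∷ f j ∷ f k ∷ []) (a ∷ b ∷ c ∷ [])
occurs? f (ab-c a b c) = any? λ i → any? λ j → any? λ k →
  (toℕ j ℕ.≟ suc (toℕ i)) ×-dec (j <? k) ×-dec
  orderIsomorphic? (f i ∷ f j ∷ f k ∷ []) (a ∷ b ∷ c ∷ [])

occurs-suc : (f : Fin (suc n) → ℕ) → ∀ {p} → Occurs (f ∘ suc) p → Occurs f p
occurs-suc f {a-bc _ _ _} (i , j , k , i<j , k≡1+j , iso) =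
  suc i , suc j , suc k , s<s i<j , cong suc k≡1+j , iso
occurs-suc f {ab-c _ _ _} (i , j , k , j≡1+i , j<k , iso) =
  suc i , suc j , suc k , cong suc j≡1+i , s<s j<k , iso

infix 4 _≃_

_≃_ : (f g : Fin n → ℕ) → Set
f ≃ g = ∀ x y → f x < f y ⇔ g x < g y

-- Phrased with `map` because `map f (i ∷ j ∷ k ∷ [])` computes to the triple in `Occurs`, whichever
-- kind of pattern is meant.
orderIsomorphic-resp-≃ : {f g : Fin n → ℕ} → f ≃ g → (is : Vec (Fin n) m) (v : Vec ℕ m) →
  OrderIsomorphic (map f is) v → OrderIsomorphic (map g is) v
orderIsomorphic-resp-≃ {f = f} {g} f≃g is v iso x y =
  subst₂ (λ s t → s < t ⇔ _) (sym (lookup-map x g is)) (sym (lookup-map y g is))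
    (⇔-trans (⇔-sym (f≃g _ _))
      (subst₂ (λ s t → s < t ⇔ _) (lookup-map x f is) (lookup-map y f is) (iso x y)))

occurs-resp-≃ : {f g : Fin n → ℕ} → f ≃ g → ∀ {p} → Occurs f p → Occurs g p
occurs-resp-≃ f≃g {a-bc a b c} (i , j , k , i<j , k≡1+j , iso) =
  i , j , k , i<j , k≡1+j , orderIsomorphic-resp-≃ f≃g (i ∷ j ∷ k ∷ []) (a ∷ b ∷ c ∷ []) iso
occurs-resp-≃ f≃g {ab-c a b c} (i , j , k , j≡1+i , j<k , iso) =
  i , j , k , j≡1+i , j<k , orderIsomorphic-resp-≃ f≃g (i ∷ j ∷ k ∷ []) (a ∷ b ∷ c ∷ []) iso

ranks : Vec (Fin m) n → Fin n → ℕ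
ranks w = toℕ ∘ lookup w

insert : Fin (suc m) → Vec (Fin m) n → Vec (Fin (suc m)) (suc n)
insert a w = a ∷ map (punchIn a) w

-- The standardised word w has no extension by d letters on the left avoiding P.
Doomed : List Pattern → ℕ → Vec (Fin m) m → Set
Doomed P zero    w = Any (Occurs (ranks w)) P
Doomed P (suc d) w = Any (Occurs (ranks w)) P ⊎ (∀ a → Doomed P d (insert a w))

doomed? : ∀ P d (w : Vec (Fin m) m) → Dec (Doomed P d w)
doomed? P zero    w = Any.any? (occurs? (ranks w)) P
doomed? P (suc d) w = Any.any? (occurs? (ranks w)) P ⊎-dec all? λ a → doomed? P d (insert a w)

-- Makes the step uniform in `d`: at depth 0 an occurrence is already present, so the value `pred 0`
-- is harmless.
doomed-step : ∀ d {w : Vec (Fin m) m} → Doomed P d w →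
  Any (Occurs (ranks w)) P ⊎ (∀ a → Doomed P (pred d) (insert a w))
doomed-step zero    = inj₁
doomed-step (suc d) doomed = doomed

-- A downward closed set is an initial segment, and `a` is its size; hence `a` has `suc m` possible
-- values.
threshold : {Q : Pred (Fin m) 0ℓ} → Decidable Q → (∀ {x y} → toℕ x ≤ toℕ y → Q y → Q x) →
  ∃[ a ] ∀ x → toℕ x < toℕ {suc m} a ⇔ Q x
threshold {zero} Q? down = zero , λ ()
threshold {suc m} Q? down with Q? zero
... | no ¬Q0 = zero , λ x → mk⇔ (λ ()) (λ Qx → contradiction (down z≤n Qx) ¬Q0)
... | yes Q0 with a , below ← threshold (Q? ∘ suc) (down ∘ s≤s) = suc a , λ where
  zero    → mk⇔ (λ _ → Q0) (λ _ → z<s)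
  (suc x) → ⇔-trans (mk⇔ s<s⁻¹ s<s) (below x)

punchIn-< : (a : Fin (suc m)) (x : Fin m) → toℕ (punchIn a x) < toℕ a ⇔ toℕ x < toℕ a
punchIn-< zero    x       = mk⇔ (λ ()) (λ ())
punchIn-< (suc a) zero    = mk⇔ (λ _ → z<s) (λ _ → z<s)
punchIn-< (suc a) (suc x) =
  ⇔-trans (mk⇔ s<s⁻¹ s<s) (⇔-trans (punchIn-< a x) (mk⇔ s<s s<s⁻¹))

-- By trichotomy, the order of two distinct numbers is settled by either one of the two strict
-- comparisons.
<-swap : ∀ {m n p q} → m ≢ n → p ≢ q → n < m ⇔ q < p → m < n ⇔ p < q
<-swap m≢n p≢q e = mk⇔
  (λ m<n → ≤∧≢⇒< (≮⇒≥ (<-asym m<n ∘ Equivalence.from e)) p≢q)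
  (λ p<q → ≤∧≢⇒< (≮⇒≥ (<-asym p<q ∘ Equivalence.to e)) m≢n)

-- The new first letter gets as its rank the number of later letters below it. The ranks of those
-- letters form an initial segment, so `threshold` yields this number.
insert-≃ : (f : Fin (suc n) → ℕ) → Injective _≡_ _≡_ f → (w : Vec (Fin n) n) →
  ranks w ≃ f ∘ suc → ∃[ a ] ranks (insert a w) ≃ f
insert-≃ {n} f f-inj w w≃f with threshold smaller? smaller-down
  where
  -- Bounding `x` by some rank, instead of equating it with one, gives downward closure by
  -- transitivity and avoids inverting `w`.
  Smaller : Fin n → Set
  Smaller x = ∃[ i ] toℕ x ≤ ranks w i × f (suc i) < f zero

  smaller? : Decidable Smaller
  smaller? x = any? λ i → (toℕ x ℕ.≤? ranks w i) ×-dec (f (suc i) ℕ.<? f zero)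

  smaller-down : ∀ {x y} → toℕ x ≤ toℕ y → Smaller y → Smaller x
  smaller-down x≤y (i , y≤wi , fi<f0) = i , ≤-trans x≤y y≤wi , fi<f0
... | a , below = a , iso
  where
  -- At an actual rank the downward closure adds nothing: `w` and `f ∘ suc` are ordered alike, so a
  -- letter of rank at most that of `j` is at most `f (suc j)`.
  smaller⇔ : ∀ i → (∃[ j ] ranks w i ≤ ranks w j × f (suc j) < f zero) ⇔ f (suc i) < f zero
  smaller⇔ i = mk⇔
    (λ (j , wi≤wj , fj<f0) →
      ≤-<-trans (≮⇒≥ λ fj<fi → <⇒≱ (Equivalence.from (w≃f j i) fj<fi) wi≤wj) fj<f0)
    (λ fi<f0 → i , ≤-refl , fi<f0)

  lower : ∀ i → toℕ (punchIn a (lookup w i)) < toℕ a ⇔ f (suc i) < f zero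
  lower i = ⇔-trans (punchIn-< a _) (⇔-trans (below (lookup w i)) (smaller⇔ i))

  iso : ranks (insert a w) ≃ f
  iso zero zero = mk⇔ (⊥-elim ∘ <-irrefl refl) (⊥-elim ∘ <-irrefl refl)
  -- The mirror image of `lower`: `punchIn a` never takes the value `a`, and `f` is injective, so no
  -- ties arise.
  iso zero (suc j) rewrite lookup-map j (punchIn a) w =
    <-swap (punchInᵢ≢i a _ ∘ sym ∘ toℕ-injective) (0≢1+n ∘ f-inj) (lower j)
  iso (suc i) zero rewrite lookup-map i (punchIn a) w = lower i
  iso (suc i) (suc j) rewrite lookup-map i (punchIn a) w | lookup-map j (punchIn a) w =
    ⇔-trans
      (mk⇔ (λ lt → ≰⇒> (<⇒≱ lt ∘ punchIn-mono-≤ a _ _))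
           (λ lt → ≰⇒> (<⇒≱ lt ∘ punchIn-cancel-≤ a _ _)))
      (w≃f i j)

-- Induction on the word, from its last letter to its first: each new letter selects one branch of
-- the search. Truncated subtraction keeps the depth at 0 from length `k` on, where `doomed-step`
-- can only return an occurrence.
doomed-sound : ∀ k → Doomed P k [] → (f : Fin n → ℕ) → Injective _≡_ _≡_ f →
  Any (Occurs f) P ⊎ (∃[ w ] ranks w ≃ f × Doomed P (k ∸ n) w)
doomed-sound {n = zero} k doomed f f-inj = inj₂ ([] , (λ ()) , doomed)
doomed-sound {P = P} {n = suc n} k doomed f f-inj
  with doomed-sound {P = P} k doomed (f ∘ suc) (suc-injective ∘ f-inj)
... | inj₁ occurs = inj₁ (Any.map (occurs-suc f) occurs)
... | inj₂ (w , w≃f , w-doomed) with doomed-step {P = P} (k ∸ n) {w} w-doomed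
...   | inj₁ occurs = inj₁ (Any.map (occurs-suc f ∘ occurs-resp-≃ w≃f) occurs)
...   | inj₂ extensions with a , aw≃f ← insert-≃ f f-inj w w≃f =
  inj₂ (insert a w , aw≃f ,
    subst (λ d → Doomed P d (insert a w)) (pred[m∸n]≡m∸[1+n] k n) (extensions a))

doomed⇒occurs : ∀ k → Doomed P k [] → n ≥ k → (f : Fin n → ℕ) → Injective _≡_ _≡_ f →
  Any (Occurs f) P
doomed⇒occurs {P = P} k doomed n≥k f f-inj with doomed-sound {P = P} k doomed f f-inj
... | inj₁ occurs = occurs
... | inj₂ (w , w≃f , w-doomed) =
  Any.map (occurs-resp-≃ w≃f) (subst (λ d → Doomed P d w) (m≤n⇒m∸n≡0 n≥k) w-doomed)

-- Both sides unfold to the same type, but only once the constructor of the pattern is known.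
occurs⇒contains : (π : Permutation′ n) → ∀ {p} → Occurs (toℕ ∘ (π ⟨$⟩ʳ_)) p → Contains π p
occurs⇒contains π {a-bc _ _ _} occ = occ
occurs⇒contains π {ab-c _ _ _} occ = occ

doomed⇒eventuallyZero : ∀ k → Doomed P k [] → EventuallyZero P
doomed⇒eventuallyZero {P = P} k doomed = k , λ n n≥k →
  let none = λ (π , avoids) → All.All¬⇒¬Any avoids
        (Any.map (occurs⇒contains π)
          (doomed⇒occurs {P = P} k doomed n≥k (toℕ ∘ (π ⟨$⟩ʳ_))
            (Injection.injective (↔⇒↣ π) ∘ toℕ-injective)))
  -- `none` refutes every element of the setoid, so its inverse with `Fin 0` is vacuous.
  in record
    { to        = λ s → ⊥-elim (none s)
    ; from      = λ ()
    ; to-cong   = λ {s} _ → ⊥-elim (none s)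
    ; from-cong = λ {}
    ; inverse   = (λ {}) , λ {s} _ → ⊥-elim (none s)
    }

-- The implicit `True` argument computes to the unit type when every search succeeds, so type
-- checking performs the searches. Depth 6 is enough for every `r` in each of the families below.
doomed-all : (Q : Pattern → List Pattern) (rs : List Pattern) →
  {True (All.all? (λ r → doomed? (Q r) 6 []) rs)} → ∀ r → r ∈ rs → EventuallyZero (Q r)
doomed-all Q rs {search} r r∈rs =
  doomed⇒eventuallyZero {P = Q r} 6 (All.lookup (toWitness search) r∈rs)

mainTheorem5 : (∀ r → r ∈ 12-3 ∷ 1-32 ∷ 13-2 ∷ 3-12 ∷ 31-2 ∷ 21-3 ∷ 2-31 ∷ 23-1 ∷ 32-1 ∷ [] →
    EventuallyZero (1-23 ∷ 2-13 ∷ 3-21 ∷ r ∷ []))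
    × (∀ r → r ∈ 12-3 ∷ 1-32 ∷ 13-2 ∷ 3-12 ∷ 31-2 ∷ 2-13 ∷ 21-3 ∷ 2-31 ∷ 3-21 ∷ [] →
    EventuallyZero (1-23 ∷ 23-1 ∷ 32-1 ∷ r ∷ []))
    × (∀ r → r ∈ 12-3 ∷ 13-2 ∷ 3-12 ∷ 31-2 ∷ 21-3 ∷ 2-31 ∷ [] →
    EventuallyZero (1-23 ∷ 2-13 ∷ 32-1 ∷ r ∷ []))
    × (∀ r → r ∈ 31-2 ∷ 1-32 ∷ 23-1 ∷ 32-1 ∷ [] →
    EventuallyZero (1-23 ∷ 12-3 ∷ 3-21 ∷ r ∷ []))
    × (∀ r → r ∈ 1-32 ∷ 13-2 ∷ 3-12 ∷ 31-2 ∷ 23-1 ∷ [] →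
    EventuallyZero (1-23 ∷ 21-3 ∷ 3-21 ∷ r ∷ []))
    × (∀ r → r ∈ 13-2 ∷ 3-12 ∷ 2-31 ∷ [] →
    EventuallyZero (1-23 ∷ 21-3 ∷ 32-1 ∷ r ∷ []))
    × EventuallyZero (1-23 ∷ 2-31 ∷ 32-1 ∷ 13-2 ∷ [])
mainTheorem5 =
    -- In these six components `_` is the list of admissible `r`, read off from the goal.
    doomed-all (λ r → 1-23 ∷ 2-13 ∷ 3-21 ∷ r ∷ []) _
  , doomed-all (λ r → 1-23 ∷ 23-1 ∷ 32-1 ∷ r ∷ []) _
  , doomed-all (λ r → 1-23 ∷ 2-13 ∷ 32-1 ∷ r ∷ []) _
  , doomed-all (λ r → 1-23 ∷ 12-3 ∷ 3-21 ∷ r ∷ []) _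
  , doomed-all (λ r → 1-23 ∷ 21-3 ∷ 3-21 ∷ r ∷ []) _
  , doomed-all (λ r → 1-23 ∷ 21-3 ∷ 32-1 ∷ r ∷ []) _
  , doomed⇒eventuallyZero {P = 1-23 ∷ 2-31 ∷ 32-1 ∷ 13-2 ∷ []} 6 (toWitness {a? = doomed? _ 6 []} _)
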